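{- Let $(\mathcal{A},\mathbf{m})$ be a cyclic sequencing problem with $n$ symbols. For every admissible cycle $C\in\Omega(\mathcal{A},\mathbf{m})$, $$\sum_{j\in\mathcal{J}_k}\Delta_j=N\qquad\text{for all }k\in\{1,\ldots,n\}.$$ Moreover, for every admissible cycle $C\in\Omega(\mathcal{A},\mathbf{m})$ the mean is invariant under symbol permutations, integer valued and equal to the number of distinct symbols, that is, $\mu(C)=n\in\mathbb{N}$.
   Context: Here $\mathbb{N}=\{1,2,\ldots\}$. A cyclic sequencing problem is a couple $(\mathcal{A},\mathbf{m})$, where $\mathcal{A}=[a_1,\ldots,a_n]$ is an alphabet of $n$ distinct symbols and $\mathbf{m}=(m_1,\ldots,m_n)\in\mathbb{N}^n$ is the vector of prescribed multiplicities. Put $N:=\sum_{k=1}^n m_k$ and $\mathbb{Z}_N:=\mathbb{Z}/N\mathbb{Z}$. A cycle is a map $C:\mathbb{Z}_N\to\mathcal{A}$, with $C_j:=C([j]_N)$; $\mathcal{J}_k:=C^{ -1}(a_k)$. It is admissible if $|\mathcal{J}_k|=m_k$ for all $k$, and $\Omega(\mathcal{A},\mathbf{m})$ is the set of admissible cycles (any two of them differ by a permutation of the positions). For a cycle $C$ and a position $j$, $\Delta_j$ is the distance in steps from position $j$ to the next instance of the same symbol around the cycle, i.e. the least integer $d\ge 1$ with $C_{j+d}=C_j$ (indices modulo $N$); so $\Delta_j=N$ if the symbol appears only once. The mean is $\mu(C):=\frac1N\sum_{j=1}^N\Delta_j$. -}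

module Defs where

open import Algebra.Properties.CommutativeMonoid.Sum using (sum)
open import Data.Bool.Base using (if_then_else_)
open import Data.Fin.Base using (Fin; zero; suc; toℕ)
open import Data.Fin.Properties as Fin using (toℕ-injective; toℕ-fromℕ<; toℕ<n)
open import Data.Fin.Subset using (Subset; ∣_∣)
open import Data.Integer.Base using (+_)
open import Data.Nat.Base
open import Data.Nat.DivMod using (_mod_; [m+n]%n≡m%n; m<n⇒m%n≡m; m%n<n)
open import Data.Nat.Properties using (+-0-commutativeMonoid; _≤?_)
open import Data.Product.Base using (∃; _×_; _,_; proj₁)
open import Data.Rational.Base as ℚ using (ℚ)
open import Data.Vec.Base using (lookup; tabulate)
open import Function.Base using (_∘_)
open import Function.Bundles using (_↔_; module Inverse)
open import Function.Construct.Symmetry using (↔-sym)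
open import Function.Properties.Inverse using (↔⇒↣)
open import Level as Level using (Level; 0ℓ)
open import Relation.Binary.Definitions using (DecidableEquality)
open import Relation.Binary.PropositionalEquality
  using (_≡_; cong; trans)
open import Relation.Nullary.Decidable using (does; yes; no; via-injection; _×-dec_)
open import Relation.Nullary.Negation using (contradiction)
open import Relation.Unary using (Pred; Decidable)

∑ : ∀ {n} → (Fin n → ℕ) → ℕ
∑ = sum +-0-commutativeMonoid

∑-subset : ∀ {n} → Subset n → (Fin n → ℕ) → ℕ
∑-subset p f = ∑ λ j → if lookup p j then f j else 0

syntax ∑-subset p (λ j → x) = ∑[ j ∈ p ] x

IsLeast : ∀ {ℓ} → Pred ℕ ℓ → Pred ℕ ℓ
IsLeast P d = P d × (∀ e → P e → d ≤ e)

least : ∀ {ℓ} {P : Pred ℕ ℓ} → Decidable P → ∀ n → P n → ∃ (IsLeast P)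
least P? zero    p = 0 , p , λ _ _ → z≤n
least P? (suc n) p with P? 0
... | yes p₀ = 0 , p₀ , λ _ _ → z≤n
... | no ¬p₀ with least (P? ∘ suc) n p
...   | d , pd , d≤ = suc d , pd , λ where
        zero    p₀ → contradiction p₀ ¬p₀
        (suc e) pe → s≤s (d≤ e pe)

∑-nonZero : ∀ {n} .{{_ : NonZero n}} (m : Fin n → ℕ) →
            (∀ k → NonZero (m k)) → NonZero (∑ m)
∑-nonZero {suc n} m m≢0 with m zero | m≢0 zero
... | suc _ | _ = _

record CyclicSequencingProblem (ℓ : Level) (n : ℕ) : Set (Level.suc ℓ) where
  field
    {{n-nonZero}} : NonZero n
    Symbol        : Set ℓ
    alphabet      : Fin n ↔ Symbol
    m             : Fin n → ℕ
    m-nonZero     : ∀ k → NonZero (m k)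

  a : Fin n → Symbol
  a = Inverse.to alphabet

  _≟_ : DecidableEquality Symbol
  _≟_ = via-injection (↔⇒↣ (↔-sym alphabet)) Fin._≟_

  N : ℕ
  N = ∑ m

  instance
    N-nonZero : NonZero N
    N-nonZero = ∑-nonZero m m-nonZero

  -- ℤ/N is represented by its canonical residues 0, …, N - 1.
  Position : Set
  Position = Fin N

  [_] : ℕ → Position
  [ j ] = j mod N

  Cycle : Set ℓ
  Cycle = Position → Symbol

  𝒥 : Cycle → Fin n → Subset N
  𝒥 C k = tabulate λ j → does (C j ≟ a k)

  Ω : Pred Cycle 0ℓ
  Ω C = ∀ k → ∣ 𝒥 C k ∣ ≡ m k

  Recurs : Cycle → Position → Pred ℕ ℓ
  Recurs C j d = 1 ≤ d × C [ toℕ j + d ] ≡ C j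

  [j+N]≡j : ∀ j → [ toℕ j + N ] ≡ j
  [j+N]≡j j = toℕ-injective
    (trans (toℕ-fromℕ< (m%n<n (toℕ j + N) N))
    (trans ([m+n]%n≡m%n (toℕ j) N) (m<n⇒m%n≡m (toℕ<n j))))

  next : ∀ C j → ∃ (IsLeast (Recurs C j))
  next C j = least (λ d → (1 ≤? d) ×-dec (C [ toℕ j + d ] ≟ C j))
                   N (>-nonZero⁻¹ N , cong C ([j+N]≡j j))

  Δ : Cycle → Position → ℕ
  Δ C j = proj₁ (next C j)

  -- The summation index i : Fin N stands for j = i + 1, so that j runs over 1, …, N.
  μ : Cycle → ℚ
  μ C = + ∑ {N} (λ i → Δ C [ suc (toℕ i) ]) ℚ./ N

{-# OPTIONS --safe #-}
-- Fix a symbol s that occurs in C, and let D i be the distance from position i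
-- to the next instance of s strictly after i, whatever symbol stands at i.
-- Then D i + [C (i+1) = s] D (i+1) = 1 + D (i+1) for every i. Summing over the
-- cycle, the sums of D (i) and D (i+1) cancel, and what is left says that the
-- sum of D over the instances of s is N; there D coincides with Δ.
-- The mean follows by splitting the sum of all Δ j according to the symbol at j.
module Submission where

open import Defs
open import Data.Bool.Base using (Bool; true; false; if_then_else_)
open import Data.Bool.Properties using (if-cong)
open import Data.Fin.Base using (Fin; zero; suc; toℕ; fromℕ; inject₁)
open import Data.Fin.Properties as Fin
  using (fromℕ<-cong; fromℕ<-toℕ; toℕ-fromℕ; toℕ-fromℕ<; toℕ-inject₁; toℕ<n; toℕ≤n)
open import Data.Fin.Permutation using (Permutation′; _⟨$⟩ʳ_)
open import Data.Fin.Subset using (∣_∣)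
open import Data.Fin.Subset.Properties using (nonempty?; Empty-unique; ∣⊥∣≡0)
open import Data.Integer.Base using (ℤ; +_)
open import Data.Integer.Properties using (pos-*) renaming (*-identityʳ to ℤ-*-identityʳ)
open import Data.Nat.Base
  using (ℕ; zero; suc; _+_; _*_; _∸_; _%_; _≤_; z≤n; s≤s; NonZero; ≢-nonZero⁻¹)
open import Data.Nat.DivMod
  using (_mod_; %-distribˡ-+; m%n%n≡m%n; m%n<n; m<n⇒m%n≡m; n%n≡0)
open import Data.Nat.Properties
  using (+-0-commutativeMonoid; +-assoc; +-cancelˡ-≡; +-comm; +-identityʳ; +-suc; *-identityʳ;
         m+[n∸m]≡n; m<n⇒0<n∸m; m≤n⇒m≤o+n; ≤-antisym; ≤-refl; _≤?_)
open import Algebra.Properties.CommutativeMonoid.Sum +-0-commutativeMonoid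
  using (∑-comm; ∑-distrib-+; sum-init-last; sum-permute; sum-replicate-zero)
  renaming (sum-cong-≗ to ∑-cong)
open import Data.Product.Base using (_×_; ∃; _,_; proj₁; proj₂)
open import Data.Rational.Base using (_/_)
open import Data.Rational.Properties using (fromℚᵘ-cong)
open import Data.Rational.Unnormalised.Base using (mkℚᵘ; *≡*)
open import Data.Vec.Base using (tabulate)
open import Data.Vec.Properties using (lookup∘tabulate; []=⇒lookup)
open import Function.Base using (_∘_)
open import Function.Bundles using (module Inverse)
open import Relation.Binary.PropositionalEquality
  using (_≡_; refl; sym; trans; cong; cong₂; subst; module ≡-Reasoning)
open import Relation.Nullary.Decidable using (Dec; does; yes; no; _×-dec_)
open import Relation.Nullary.Negation using (¬_; contradiction)
open import Relation.Unary using (Pred; _∈_)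

open ≡-Reasoning

-- Least elements, conditionals and finite sums.

IsLeast-unique : ∀ {ℓ} {P : Pred ℕ ℓ} {d e} → IsLeast P d → IsLeast P e → d ≡ e
IsLeast-unique (pd , d≤) (pe , e≤) = ≤-antisym (d≤ _ pe) (e≤ _ pd)

does⇒ : ∀ {a} {A : Set a} (a? : Dec A) → does a? ≡ true → A
does⇒ (yes a) _ = a

-- The equation is asked for only in the branch where `A` holds; this lets `Δ` be traded for `D` at
-- the instances of a symbol, where alone the two are known to agree.
if-does-congˡ : ∀ {a b} {A : Set a} {B : Set b} (a? : Dec A) {x y z : B} → (A → x ≡ y) →
                (if does a? then x else z) ≡ (if does a? then y else z)
if-does-congˡ (yes a) x≡y = x≡y a
if-does-congˡ (no _)  _   = refl

∑-const : ∀ n c → ∑ {n} (λ _ → c) ≡ n * c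
∑-const zero    c = refl
∑-const (suc n) c = cong₂ _+_ refl (∑-const n c)

∑-suc : ∀ {n} (f : Fin n → ℕ) → ∑ (λ i → suc (f i)) ≡ n + ∑ f
∑-suc {n} f = trans (∑-distrib-+ (λ _ → 1) f)
  (cong₂ _+_ (trans (∑-const n 1) (*-identityʳ n)) refl)

∑-subset-tabulate : ∀ {n} (b : Fin n → Bool) (f : Fin n → ℕ) →
                    ∑-subset (tabulate b) f ≡ ∑ (λ j → if b j then f j else 0)
∑-subset-tabulate b f = ∑-cong λ j → if-cong {x = f j} (lookup∘tabulate b j)

∑-delta : ∀ {n} (i : Fin n) x → ∑ (λ k → if does (i Fin.≟ k) then x else 0) ≡ x
∑-delta {suc n} zero    x = trans (cong₂ _+_ refl (sum-replicate-zero n)) (+-identityʳ x)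
∑-delta {suc n} (suc i) x = ∑-delta i x

∣tabulate∣ : ∀ {n} (b : Fin n → Bool) → ∣ tabulate b ∣ ≡ ∑ (λ j → if b j then 1 else 0)
∣tabulate∣ {zero}  b = refl
∣tabulate∣ {suc n} b with b zero
... | true  = cong suc (∣tabulate∣ (b ∘ suc))
... | false = ∣tabulate∣ (b ∘ suc)

-- Residues and cyclic shifts.

module _ {n} .{{_ : NonZero n}} where

  mod-cong : ∀ x y → x % n ≡ y % n → x mod n ≡ y mod n
  mod-cong x y eq = fromℕ<-cong _ _ eq _ _

  toℕ-mod : ∀ x → toℕ (x mod n) ≡ x % n
  toℕ-mod x = toℕ-fromℕ< (m%n<n x n)

  mod-toℕ : ∀ (j : Fin n) → toℕ j mod n ≡ j
  mod-toℕ j = trans (fromℕ<-cong _ _ (m<n⇒m%n≡m (toℕ<n j)) _ (toℕ<n j)) (fromℕ<-toℕ j _)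

  mod-+ : ∀ x d → (toℕ (x mod n) + d) mod n ≡ (x + d) mod n
  mod-+ x d = mod-cong (toℕ (x mod n) + d) (x + d) (begin
    (toℕ (x mod n) + d) % n      ≡⟨ cong (λ y → (y + d) % n) (toℕ-mod x) ⟩
    (x % n + d) % n              ≡⟨ %-distribˡ-+ (x % n) d n ⟩
    (x % n % n + d % n) % n      ≡⟨ cong (λ y → (y + d % n) % n) (m%n%n≡m%n x n) ⟩
    (x % n + d % n) % n          ≡⟨ %-distribˡ-+ x d n ⟨
    (x + d) % n                  ∎)

-- The shift sends every index but the last to its successor and wraps the last to 0, so splitting
-- off the last term on one side matches splitting off the first on the other.
∑-rotate : ∀ n .{{_ : NonZero n}} (f : Fin n → ℕ) →
           ∑ {n} (λ i → f (suc (toℕ i) mod n)) ≡ ∑ f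
∑-rotate n@(suc n-1) f = begin
  ∑ g                                   ≡⟨ sum-init-last g ⟩
  ∑ (g ∘ inject₁) + g (fromℕ n-1)       ≡⟨ cong₂ _+_ (∑-cong (cong f ∘ inner)) (cong f wrap) ⟩
  ∑ (f ∘ suc) + f zero                  ≡⟨ +-comm _ (f zero) ⟩
  f zero + ∑ (f ∘ suc)                  ∎
  where
  g : Fin n → ℕ
  g i = f (suc (toℕ i) mod n)

  inner : ∀ i → suc (toℕ (inject₁ i)) mod n ≡ suc i
  inner i = trans (cong (λ x → suc x mod n) (toℕ-inject₁ i)) (mod-toℕ (suc i))

  wrap : suc (toℕ (fromℕ n-1)) mod n ≡ zero
  wrap = mod-cong (suc (toℕ (fromℕ n-1))) 0 (trans (cong (λ x → suc x % n) (toℕ-fromℕ n-1)) (n%n≡0 n))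

-- Cross-multiplication settles the equality of unnormalised fractions, and normalisation respects
-- it.
n*N/N≡n/1 : ∀ n N .{{_ : NonZero N}} → + (n * N) / N ≡ + n / 1
n*N/N≡n/1 n N@(suc N-1) = fromℚᵘ-cong {mkℚᵘ (+ (n * N)) N-1} {mkℚᵘ (+ n) 0}
  (*≡* (trans (ℤ-*-identityʳ _) (pos-* n N)))

module _ {ℓ n} (P : CyclicSequencingProblem ℓ n) where
  open CyclicSequencingProblem P

  -- An empty class would have size 0, but admissibility gives it the nonzero size `m k`. The
  -- witness ensures that the search for the next instance of `a k` succeeds from every position.
  𝒥-nonempty : ∀ C → C ∈ Ω → ∀ k → ∃ λ j → C j ≡ a k
  𝒥-nonempty C C∈Ω k with nonempty? (𝒥 C k)
  ... | yes (j , j∈𝒥) =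
    j , does⇒ (C j ≟ a k) (trans (sym (lookup∘tabulate _ j)) ([]=⇒lookup j∈𝒥))
  ... | no empty = contradiction
    (trans (sym (C∈Ω k)) (trans (cong ∣_∣ (Empty-unique empty)) (∣⊥∣≡0 N)))
    (≢-nonZero⁻¹ (m k) {{m-nonZero k}})

  -- Distance to the next instance of a fixed symbol.

  module Return (C : Cycle) (s : Symbol) (j₀ : Position) (Cj₀≡s : C j₀ ≡ s) where

    Hits : Position → Pred ℕ ℓ
    Hits i d = 1 ≤ d × C [ toℕ i + d ] ≡ s

    -- The witness j₀ + (N - i) is positive even when j₀ comes before i.
    hit : ∀ i → Hits i (toℕ j₀ + (N ∸ toℕ i))
    hit i = m≤n⇒m≤o+n (toℕ j₀) (m<n⇒0<n∸m (toℕ<n i)) , (begin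
      C [ toℕ i + (toℕ j₀ + (N ∸ toℕ i)) ]  ≡⟨ cong (C ∘ [_]) lem ⟩
      C [ toℕ j₀ + N ]                      ≡⟨ cong C ([j+N]≡j j₀) ⟩
      C j₀                                  ≡⟨ Cj₀≡s ⟩
      s                                     ∎)
      where
      lem : toℕ i + (toℕ j₀ + (N ∸ toℕ i)) ≡ toℕ j₀ + N
      lem = begin
        toℕ i + (toℕ j₀ + (N ∸ toℕ i))  ≡⟨ +-assoc (toℕ i) (toℕ j₀) _ ⟨
        toℕ i + toℕ j₀ + (N ∸ toℕ i)    ≡⟨ cong₂ _+_ (+-comm (toℕ i) (toℕ j₀)) refl ⟩
        toℕ j₀ + toℕ i + (N ∸ toℕ i)    ≡⟨ +-assoc (toℕ j₀) (toℕ i) _ ⟩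
        toℕ j₀ + (toℕ i + (N ∸ toℕ i))  ≡⟨ cong₂ _+_ refl (m+[n∸m]≡n (toℕ≤n i)) ⟩
        toℕ j₀ + N                      ∎

    firstHit : ∀ i → ∃ (IsLeast (Hits i))
    firstHit i = least (λ d → (1 ≤? d) ×-dec (C [ toℕ i + d ] ≟ s)) _ (hit i)

    D : Position → ℕ
    D = proj₁ ∘ firstHit

    D-least : ∀ i → IsLeast (Hits i) (D i)
    D-least = proj₂ ∘ firstHit

    next-position : Position → Position
    next-position i = [ suc (toℕ i) ]

    atInstance : Position → ℕ
    atInstance i = if does (C i ≟ s) then D i else 0

    Δ≡D-on-s : ∀ i → (if does (C i ≟ s) then Δ C i else 0) ≡ atInstance i
    Δ≡D-on-s i = if-does-congˡ (C i ≟ s) λ Ci≡s → IsLeast-unique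
      -- `Δ C i` is least for the target `C i`; transport along `Ci≡s` turns the target into `s`,
      -- the one that defines `D i`.
      (subst (λ t → IsLeast (λ d → 1 ≤ d × C [ toℕ i + d ] ≡ t) (Δ C i)) Ci≡s (proj₂ (next C i)))
      (D-least i)

    D-hit : ∀ i → C (next-position i) ≡ s → D i ≡ 1
    D-hit i eq = IsLeast-unique (D-least i)
      -- Nothing smaller than 1 competes, since `Hits` demands a positive distance.
      ((≤-refl , trans (cong (C ∘ [_]) (+-comm (toℕ i) 1)) eq) , λ _ → proj₁)

    -- A hit at distance d from the next position is a hit at distance d + 1 from `i`, and
    -- conversely when d is positive. The only distance from `i` left over is 1, which the miss
    -- excludes.
    D-miss : ∀ i → ¬ C (next-position i) ≡ s → D i ≡ suc (D (next-position i))
    D-miss i miss = IsLeast-unique (D-least i) ((s≤s z≤n , trans (sym (shift _)) hits) , minimal)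
      where
      shift : ∀ d → C [ toℕ (next-position i) + d ] ≡ C [ toℕ i + suc d ]
      shift d = cong C (trans (mod-+ (suc (toℕ i)) d) (cong [_] (sym (+-suc (toℕ i) d))))

      hits = proj₂ (proj₁ (D-least (next-position i)))

      minimal : ∀ e → Hits i e → suc (D (next-position i)) ≤ e
      minimal 1 (_ , eq) = contradiction (trans (cong (C ∘ [_]) (+-comm 1 (toℕ i))) eq) miss
      minimal (suc (suc e)) (_ , eq) =
        s≤s (proj₂ (D-least (next-position i)) (suc e) (s≤s z≤n , trans (shift (suc e)) eq))

    -- On a hit `D i` is 1 and the added term supplies the distance from the next position; on a
    -- miss the added term is 0. Writing the correction as an addition avoids truncated subtraction.
    D-step : ∀ i → D i + atInstance (next-position i) ≡ suc (D (next-position i))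
    D-step i = step (C i⁺ ≟ s)
      where
      i⁺ = next-position i

      step : (hit? : Dec (C i⁺ ≡ s)) → D i + (if does hit? then D i⁺ else 0) ≡ suc (D i⁺)
      step (yes eq)  = cong (λ d → d + D i⁺) (D-hit i eq)
      step (no miss) = trans (+-identityʳ _) (D-miss i miss)

    ∑-atInstance : ∑ atInstance ≡ N
    ∑-atInstance = +-cancelˡ-≡ (∑ D) _ _ (begin
      ∑ D + ∑ atInstance                               ≡⟨ cong₂ _+_ refl (∑-rotate N atInstance) ⟨
      ∑ D + ∑ (atInstance ∘ next-position)             ≡⟨ ∑-distrib-+ D _ ⟨
      ∑ (λ i → D i + atInstance (next-position i))     ≡⟨ ∑-cong D-step ⟩
      ∑ (λ i → suc (D (next-position i)))              ≡⟨ ∑-suc (D ∘ next-position) ⟩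
      N + ∑ (D ∘ next-position)                        ≡⟨ cong₂ _+_ refl (∑-rotate N D) ⟩
      N + ∑ D                                          ≡⟨ +-comm N (∑ D) ⟩
      ∑ D + N                                          ∎)

  -- Sums over symbol classes and the mean.

  ∑-𝒥-Δ : ∀ C → C ∈ Ω → ∀ k → ∑[ j ∈ 𝒥 C k ] Δ C j ≡ N
  ∑-𝒥-Δ C C∈Ω k = begin
    ∑[ j ∈ 𝒥 C k ] Δ C j                                ≡⟨ ∑-subset-tabulate (λ j → does (C j ≟ a k)) (Δ C) ⟩
    ∑ (λ j → if does (C j ≟ a k) then Δ C j else 0)     ≡⟨ ∑-cong Δ≡D-on-s ⟩
    ∑ atInstance                                        ≡⟨ ∑-atInstance ⟩
    N                                                   ∎
    where
    occurrence = 𝒥-nonempty C C∈Ω k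
    open Return C (a k) (proj₁ occurrence) (proj₂ occurrence)

  -- The alphabet is a bijection, so exactly one index names `t`. Read backwards, this splits a term
  -- over all symbols.
  ∑-symbols : ∀ t x → ∑ (λ k → if does (t ≟ a k) then x else 0) ≡ x
  ∑-symbols t x = trans (∑-cong (λ k → if-cong (does-≟ k))) (∑-delta (from t) x)
    where
    open Inverse alphabet
    does-≟ : ∀ k → does (t ≟ a k) ≡ does (from t Fin.≟ k)
    -- `_≟_` decides by comparing indices under `from`, so only `from (a k)` has to be rewritten to
    -- `k`.
    does-≟ k = cong (λ i → does (from t Fin.≟ i)) (strictlyInverseʳ k)

  ∑-Δ : ∀ C → C ∈ Ω → ∑ (Δ C) ≡ n * N
  ∑-Δ C C∈Ω = begin
    ∑ (Δ C)
      ≡⟨ ∑-cong (λ j → ∑-symbols (C j) (Δ C j)) ⟨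
    ∑ (λ j → ∑ (λ k → if does (C j ≟ a k) then Δ C j else 0))
      ≡⟨ ∑-comm (λ j k → if does (C j ≟ a k) then Δ C j else 0) ⟩
    ∑ (λ k → ∑ (λ j → if does (C j ≟ a k) then Δ C j else 0))
      ≡⟨ ∑-cong (λ k → ∑-subset-tabulate (λ j → does (C j ≟ a k)) (Δ C)) ⟨
    ∑ (λ k → ∑[ j ∈ 𝒥 C k ] Δ C j)
      ≡⟨ ∑-cong (∑-𝒥-Δ C C∈Ω) ⟩
    ∑ {n} (λ _ → N)
      ≡⟨ ∑-const n N ⟩
    n * N ∎

  μ≡n : ∀ C → C ∈ Ω → μ C ≡ + n / 1
  μ≡n C C∈Ω = trans
    -- `μ` sums over the positions 1, ..., N modulo `N`; rotation brings them back to 0, ..., N - 1.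
    (cong (λ x → + x / N) (trans (∑-rotate N (Δ C)) (∑-Δ C C∈Ω)))
    (n*N/N≡n/1 n N)

  -- The size of a class is a sum of indicators, which reindexing by a bijection preserves. Hence
  -- the value of the mean is available for the permuted cycle too.
  Ω-permute : ∀ C → C ∈ Ω → (π : Permutation′ N) → C ∘ (π ⟨$⟩ʳ_) ∈ Ω
  Ω-permute C C∈Ω π k = begin
    ∣ 𝒥 (C ∘ (π ⟨$⟩ʳ_)) k ∣        ≡⟨ ∣tabulate∣ (λ j → does (C (π ⟨$⟩ʳ j) ≟ a k)) ⟩
    ∑ (indicator ∘ (π ⟨$⟩ʳ_))      ≡⟨ sum-permute indicator π ⟨
    ∑ indicator                    ≡⟨ ∣tabulate∣ (λ j → does (C j ≟ a k)) ⟨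
    ∣ 𝒥 C k ∣                      ≡⟨ C∈Ω k ⟩
    m k                            ∎
    where
    indicator : Position → ℕ
    indicator j = if does (C j ≟ a k) then 1 else 0

lemma1 : ∀ {ℓ} {n : ℕ} (P : CyclicSequencingProblem ℓ n) →
    let open CyclicSequencingProblem P in
    (∀ (C : Cycle) → C ∈ Ω → ∀ (k : Fin n) → ∑[ j ∈ 𝒥 C k ] Δ C j ≡ N) ×
    (∀ (C : Cycle) → C ∈ Ω →
    (∀ (π : Permutation′ N) → μ (C ∘ (π ⟨$⟩ʳ_)) ≡ μ C) ×
    (∃ λ (z : ℤ) → μ C ≡ z / 1) ×
    μ C ≡ + n / 1)
lemma1 {n = n} P =
  ∑-𝒥-Δ P ,
  λ C C∈Ω →
    -- The individual distances may change under `π`; the means agree because each equals `n`.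
    (λ π → trans (μ≡n P _ (Ω-permute P C C∈Ω π)) (sym (μ≡n P C C∈Ω))) ,
    (+ n , μ≡n P C C∈Ω) ,
    μ≡n P C C∈Ω
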